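{- There exists a constant $c>0$ such that the $k\times k$ grid $P_k\,\square\,P_k$ satisfies $\mathcal{D}(P_k\,\square\,P_k,\mathcal{T}_n)\ge ck$, where $n=k^2$; i.e. for every labeling $f$ of the edges of $P_k\,\square\,P_k$ by $\{ -1,1\}$ there is a spanning tree $T$ with $\left|\sum_{e\in E(T)}f(e)\right|\ge ck$.
   Context: $P_k$ is the path on $k$ vertices and $\square$ is the Cartesian product of graphs, so $P_k\,\square\,P_k$ is the $k\times k$ grid graph with $k^2$ vertices. For a graph $G$, a family $\mathcal{S}_G$ of subgraphs of $G$ and $f:E(G)\to\{ -1,1\}$, put $f(S)=\sum_{e\in E(S)}f(e)$ for $S\in\mathcal{S}_G$; the discrepancy is $\mathcal{D}(G,\mathcal{S}_G)=\min_f\max_{S\in\mathcal{S}_G}|f(S)|$, the minimum being over all $f:E(G)\to\{ -1,1\}$. $\mathcal{T}_n$ is the set of spanning trees of $G$, where $n$ is the number of vertices of $G$.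
   Formalization: The bound is stated for k ≥ 2: for k = 1 the grid is a single vertex with no edges, so its only spanning tree has sum 0 and the inequality fails for every c > 0. -}

module Defs where

import Algebra.Properties.Monoid.Sum
open import Data.Bool using (Bool; T; if_then_else_)
open import Data.Fin using (Fin; zero; suc; inject₁; fromℕ)
open import Data.Fin.Properties using (+↔⊎; *↔×; suc-injective; toℕ-inject₁)
import Data.Fin as Fin
open import Data.Integer using (ℤ; +_; 0ℤ; ∣_∣; _◃_)
import Data.Integer.Properties as ℤ
open import Data.Nat using (ℕ; zero; suc; pred; _+_; _*_; _≤_)
open import Data.Nat.Properties using (1+n≢n; m≢1+n+m)
open import Data.Product using (_×_; _,_; ∃; ∃-syntax; proj₁; proj₂)
open import Data.Product.Function.NonDependent.Propositional using (_×-↔_)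
open import Data.Rational using (ℚ; _/_)
open import Data.Sign using (Sign)
open import Data.Sum using (_⊎_; inj₁; inj₂)
open import Data.Sum.Function.Propositional using (_⊎-↔_)
open import Function using (_↔_; Inverse; Injective)
open import Function.Construct.Composition using (_↔-∘_)
open import Function.Construct.Identity using (↔-id)
open import Function.Construct.Symmetry using (↔-sym)
open import Relation.Binary.Construct.Closure.ReflexiveTransitive using (Star)
open import Relation.Binary.PropositionalEquality
  using (_≡_; refl; sym; trans; cong)
open import Relation.Nullary using (¬_; contradiction)

module ℤ-Sum = Algebra.Properties.Monoid.Sum ℤ.+-0-monoid

-- `ends e` lists the two endpoints of the undirected edge e in an arbitrary
-- order; `Joins` forgets that order.
Joins : {V E : Set} → (E → V × V) → E → V → V → Set
Joins ends e u v = ends e ≡ (u , v) ⊎ ends e ≡ (v , u)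

-- Finite simple graphs.
record Graph : Set₁ where
  field
    V E        : Set
    #V #E      : ℕ
    V-finite   : V ↔ Fin #V
    E-finite   : E ↔ Fin #E
    ends       : E → V × V
    loopless   : ∀ {e v} → ¬ Joins ends e v v
    noParallel : ∀ {e e′ u v} → Joins ends e u v → Joins ends e′ u v → e ≡ e′

open Graph using (V; E)

private
  pathEnds : ∀ k → Fin (pred k) → Fin k × Fin k
  pathEnds (suc _) i = inject₁ i , suc i

  inject₁≢suc : ∀ {n} {i : Fin n} → ¬ inject₁ i ≡ suc i
  inject₁≢suc {i = i} eq =
    1+n≢n (sym (trans (sym (toℕ-inject₁ i)) (cong Fin.toℕ eq)))

  pathLoopless : ∀ k {e v} → ¬ Joins (pathEnds k) e v v
  pathLoopless (suc _) (inj₁ eq) = inject₁≢suc (trans (cong proj₁ eq) (sym (cong proj₂ eq)))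
  pathLoopless (suc _) (inj₂ eq) = inject₁≢suc (trans (cong proj₁ eq) (sym (cong proj₂ eq)))

  crossed : ∀ {n} {i j : Fin n} → inject₁ i ≡ suc j → ¬ suc i ≡ inject₁ j
  crossed {i = i} {j} p q = m≢1+n+m (Fin.toℕ i) {1}
    (trans (sym (toℕ-inject₁ i))
      (trans (cong Fin.toℕ p)
        (cong suc (trans (sym (toℕ-inject₁ j)) (sym (cong Fin.toℕ q))))))

  pathNoParallel : ∀ k {e e′ u v} → Joins (pathEnds k) e u v → Joins (pathEnds k) e′ u v → e ≡ e′
  pathNoParallel (suc _) (inj₁ p) (inj₁ q) = suc-injective (cong proj₂ (trans p (sym q)))
  pathNoParallel (suc _) (inj₂ p) (inj₂ q) = suc-injective (cong proj₂ (trans p (sym q)))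
  pathNoParallel (suc _) (inj₁ p) (inj₂ q) = contradiction
    (trans (cong proj₂ p) (sym (cong proj₁ q)))
    (crossed (trans (cong proj₁ p) (sym (cong proj₂ q))))
  pathNoParallel (suc _) (inj₂ p) (inj₁ q) = contradiction
    (trans (cong proj₂ p) (sym (cong proj₁ q)))
    (crossed (trans (cong proj₁ p) (sym (cong proj₂ q))))

P : ℕ → Graph
P k = record
  { V = Fin k ; E = Fin (pred k)
  ; #V = k ; #E = pred k
  ; V-finite = ↔-id _ ; E-finite = ↔-id _
  ; ends = pathEnds k
  ; loopless = pathLoopless k
  ; noParallel = pathNoParallel k
  }

module _ (G H : Graph) where
  private
    module G = Graph G
    module H = Graph H

    □E : Set
    □E = (G.E × H.V) ⊎ (G.V × H.E)

    □ends : □E → (G.V × H.V) × (G.V × H.V)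
    □ends (inj₁ (e , w)) = let (u , v) = G.ends e in (u , w) , (v , w)
    □ends (inj₂ (v , e)) = let (w , x) = H.ends e in (v , w) , (v , x)

    data View : □E → G.V × H.V → G.V × H.V → Set where
      left  : ∀ {e u v w} → Joins G.ends e u v → View (inj₁ (e , w)) (u , w) (v , w)
      right : ∀ {e v w x} → Joins H.ends e w x → View (inj₂ (v , e)) (v , w) (v , x)

    view : ∀ e {p q} → Joins □ends e p q → View e p q
    view (inj₁ _) (inj₁ refl) = left (inj₁ refl)
    view (inj₁ _) (inj₂ refl) = left (inj₂ refl)
    view (inj₂ _) (inj₁ refl) = right (inj₁ refl)
    view (inj₂ _) (inj₂ refl) = right (inj₂ refl)

    □loopless : ∀ {e p} → ¬ Joins □ends e p p
    □loopless {e} j with view e j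
    ... | left i  = G.loopless i
    ... | right i = H.loopless i

    □noParallel : ∀ {e e′ p q} → Joins □ends e p q → Joins □ends e′ p q → e ≡ e′
    □noParallel {e} {e′} j j′ with view e j | view e′ j′
    ... | left i  | left i′  = cong (λ a → inj₁ (a , _)) (G.noParallel i i′)
    ... | right i | right i′ = cong (λ a → inj₂ (_ , a)) (H.noParallel i i′)
    ... | left i  | right i′ = contradiction i G.loopless
    ... | right i | left i′  = contradiction i H.loopless

  infixr 7 _□_

  _□_ : Graph
  _□_ = record
    { V = G.V × H.V ; E = □E
    ; #V = G.#V * H.#V ; #E = G.#E * H.#V + G.#V * H.#E
    ; V-finite = ↔-sym *↔× ↔-∘ (G.V-finite ×-↔ H.V-finite)
    ; E-finite = ↔-sym +↔⊎ ↔-∘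
        ((↔-sym *↔× ↔-∘ (G.E-finite ×-↔ H.V-finite)) ⊎-↔
         (↔-sym *↔× ↔-∘ (G.V-finite ×-↔ H.E-finite)))
    ; ends = □ends
    ; loopless = □loopless
    ; noParallel = □noParallel
    }

-- Vertex and edge sets are given by their characteristic functions.
record Subgraph (G : Graph) : Set where
  open Graph G using (ends)
  field
    hasV   : V G → Bool
    hasE   : E G → Bool
    closed : ∀ e → T (hasE e) → T (hasV (proj₁ (ends e))) × T (hasV (proj₂ (ends e)))

  Adj : V G → V G → Set
  Adj u v = ∃[ e ] (T (hasE e) × Joins ends e u v)

  Connected : Set
  Connected = ∀ u v → T (hasV u) → T (hasV v) → Star Adj u v

  -- A cycle c₀ c₁ … cₗ c₀ on l + 1 ≥ 3 distinct vertices.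
  record Cycle : Set where
    field
      l        : ℕ
      2≤l      : 2 ≤ l
      c        : Fin (suc l) → V G
      distinct : Injective _≡_ _≡_ c
      step     : ∀ (i : Fin l) → Adj (c (inject₁ i)) (c (suc i))
      close    : Adj (c (fromℕ l)) (c zero)

  Acyclic : Set
  Acyclic = ¬ Cycle

  IsTree : Set
  IsTree = ∃ (λ v → T (hasV v)) × Connected × Acyclic

  Spanning : Set
  Spanning = ∀ v → T (hasV v)

SpanningTree : (G : Graph) → Subgraph G → Set
SpanningTree G S = Subgraph.Spanning S × Subgraph.IsTree S

Labeling : Graph → Set
Labeling G = E G → Sign

-- f(S) = Σ_{e ∈ E(S)} f(e), where the sign s stands for the integer s ◃ 1 = ±1.
weight : (G : Graph) → Labeling G → Subgraph G → ℤ
weight G f S = ℤ-Sum.sum (λ i → term (Inverse.from (Graph.E-finite G) i))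
  where
  term : E G → ℤ
  term e = if Subgraph.hasE S e then f e ◃ 1 else 0ℤ

IsMaximum IsMinimum : (ℕ → Set) → ℕ → Set
IsMaximum A d = A d × (∀ x → A x → x ≤ d)
IsMinimum A d = A d × (∀ x → A x → d ≤ x)

-- d = min_f max_{S ∈ 𝒮} |f(S)|, as a relation: the family 𝒮 need not be
-- decidable, so the extrema are not computable in general.
IsDiscrepancy : (G : Graph) → (Subgraph G → Set) → ℕ → Set
IsDiscrepancy G 𝒮 = IsMinimum (λ m → ∃[ f ] IsMaximum (values f) m)
  where
  values : Labeling G → ℕ → Set
  values f x = ∃[ S ] (𝒮 S × x ≡ ∣ weight G f S ∣)

fromℕℚ : ℕ → ℚ
fromℕℚ n = + n / 1

{-# OPTIONS --safe #-}

-- Root the grid at a corner: every vertex off the two sides through the root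
-- may take either its vertical or its horizontal edge towards the root as its
-- parent edge, and each choice gives a spanning tree. The heaviest and the
-- lightest of these trees differ by twice the number of faces whose two edges
-- meeting at one fixed corner have different labels. If all spanning trees have
-- |weight| ≤ M, applying this to three of the four roots leaves at most 3M faces
-- with non-constant labels. If M is small compared to k, some row of faces has
-- constant labels t, and so have almost all columns, so all but O(kM) vertical
-- edges are labelled t, and the comb made of all vertical edges and one
-- horizontal side is far from balanced.
module Submission where

open import Defs
open import Data.Nat using (ℕ; _≤_)
open import Data.Integer using (∣_∣)
open import Data.Product using (_×_; ∃-syntax)
import Data.Rational as ℚ

import Algebra.Properties.Semiring.Sum
open import Data.Bool using (Bool; true; false; not; T; if_then_else_)
open import Data.Fin using (Fin; zero; suc; inject₁; fromℕ; toℕ; _↑ˡ_; _↑ʳ_; combine)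
open import Data.Fin.Properties using (toℕ-inject₁; toℕ<n; splitAt-↑ˡ; splitAt-↑ʳ; remQuot-combine)
import Data.Fin.Relation.Unary.Top as Top
open import Data.Integer as ℤ using (ℤ; +_; 0ℤ; _◃_)
import Data.Integer.Properties as ℤₚ
import Data.Integer.Tactic.RingSolver as ℤ-Ring
open import Data.List using (List; []; _∷_)
open import Data.List.Relation.Unary.All using (All; []; _∷_)
open import Data.Maybe using (Maybe; just; nothing; maybe)
open import Data.Nat using (zero; suc; _+_; _*_; _∸_; _<_; z≤n; s≤s)
open import Data.Nat.Induction using (<-rec)
import Data.Nat.Properties as ℕₚ
import Data.Nat.Tactic.RingSolver as ℕ-Ring
open import Data.Product using (_,_; ∃; proj₁; proj₂)
import Data.Rational.Properties as ℚₚ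
open import Data.Rational.Unnormalised as ℚᵘ using (mkℚᵘ; *≤*)
import Data.Rational.Unnormalised.Properties as ℚᵘₚ
open import Data.Sign using (Sign)
open import Data.Sum using (_⊎_; inj₁; inj₂; swap)
open import Data.Unit using (tt)
open import Function using (_∘_; Inverse)
open import Relation.Binary.Construct.Closure.ReflexiveTransitive
  using (Star; ε; _◅_; _◅◅_; reverse)
open import Relation.Binary.PropositionalEquality
open import Relation.Nullary using (¬_; contradiction)

open import Data.List.Extrema ℕₚ.≤-totalOrder using (argmax; f[⊥]≤f[argmax]; f[xs]≤f[argmax])

module ℕ∑ = Algebra.Properties.Semiring.Sum ℕₚ.+-*-semiring
module ℤ∑ = Algebra.Properties.Semiring.Sum ℤₚ.+-*-semiring

-- Spanning trees from a rank and a parent function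

maximiser : ∀ {n} (r : Fin (suc n) → ℕ) → ∃[ i ] (∀ j → r j ≤ r i)
maximiser {zero} r = zero , λ { zero → ℕₚ.≤-refl }
maximiser {suc n} r with maximiser (r ∘ suc)
... | i , max with ℕₚ.≤-total (r zero) (r (suc i))
... | inj₁ le = suc i , λ { zero → le ; (suc j) → max j }
... | inj₂ ge = zero , λ { zero → ℕₚ.≤-refl ; (suc j) → ℕₚ.≤-trans (max j) ge }

module _ {G : Graph} (S : Subgraph G) where
  open Subgraph S

  Adj-sym : ∀ {u v} → Adj u v → Adj v u
  Adj-sym (e , e∈S , j) = e , e∈S , swap j

  -- The predecessor and successor along the cycle, wrapping around at `zero` and `fromℕ`. Their
  -- indices differ because a cycle has at least three vertices.
  cycle-neighbours : (C : Cycle) → let open Cycle C in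
    ∀ i → ∃[ p ] ∃[ q ] (¬ p ≡ q × Adj (c i) (c p) × Adj (c i) (c q))
  cycle-neighbours record { l = suc (suc l) ; step = step ; close = close } zero =
    suc zero , fromℕ (suc (suc l)) , (λ ()) , step zero , Adj-sym close
  cycle-neighbours record { l = suc (suc l) ; step = step ; close = close } (suc j)
    with Top.view j
  ... | Top.‵fromℕ = inject₁ j , zero , (λ ()) , Adj-sym (step j) , close
  ... | Top.‵inject₁ j′ = inject₁ j , suc (suc j′) , distinct , Adj-sym (step j) , step (suc j′)
    where
    distinct : ¬ inject₁ (inject₁ j′) ≡ suc (suc j′)
    distinct eq = ℕₚ.m≢1+n+m (toℕ j′) {1}
      (trans (sym (trans (toℕ-inject₁ (inject₁ j′)) (toℕ-inject₁ j′))) (cong toℕ eq))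
  cycle-neighbours record { l = suc zero ; 2≤l = s≤s () } _

  -- In a cycle, both neighbours of a vertex of maximal rank would be its parent.
  rooted⇒spanningTree : (rank : Graph.V G → ℕ) (parent : Graph.V G → Graph.V G) (root : Graph.V G) →
    Spanning →
    (∀ v → v ≡ root ⊎ (Adj v (parent v) × rank (parent v) < rank v)) →
    (∀ {v u} → Adj v u → (u ≡ parent v × rank u < rank v) ⊎ (v ≡ parent u × rank v < rank u)) →
    SpanningTree G S
  rooted⇒spanningTree rank parent root spanning descend oriented =
    spanning , (root , spanning root) ,
    (λ u v _ _ → toRoot u ◅◅ reverse Adj-sym (toRoot v)) , acyclic
    where
    toRoot′ : ∀ n v → rank v ≡ n → Star Adj v root
    toRoot′ = <-rec _ λ n rec v v≡n → go n rec v v≡n (descend v)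
      where
      go : ∀ n → (∀ {k} → k < n → ∀ v → rank v ≡ k → Star Adj v root) →
        ∀ v → rank v ≡ n → v ≡ root ⊎ (Adj v (parent v) × rank (parent v) < rank v) → Star Adj v root
      go n rec v v≡n (inj₁ refl) = ε
      go n rec v refl (inj₂ (a , lt)) = a ◅ rec lt (parent v) refl

    toRoot : ∀ v → Star Adj v root
    toRoot v = toRoot′ (rank v) v refl

    isParent : ∀ {v u} → Adj v u → rank u ≤ rank v → u ≡ parent v
    isParent a le with oriented a
    ... | inj₁ (eq , _) = eq
    ... | inj₂ (_ , lt) = contradiction le (ℕₚ.<⇒≱ lt)

    acyclic : Acyclic
    acyclic C with maximiser (rank ∘ Cycle.c C)
    ... | i , max with cycle-neighbours C i
    ... | p , q , p≢q , ap , aq =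
      p≢q (Cycle.distinct C (trans (isParent ap (max p)) (sym (isParent aq (max q)))))

-- Rooted paths

pathEnds : ∀ m → Fin m → Fin (suc m) × Fin (suc m)
pathEnds m = Graph.ends (P (suc m))

-- Each edge `i` is the parent edge of exactly one non-root vertex, `child i`, so edges index the
-- vertices other than the root. With one rooting per coordinate, all corners of the grid are
-- handled by the same argument.
record Rooting (m : ℕ) : Set where
  field
    child parent : Fin m → Fin (suc m)
    root         : Fin (suc m)
    rank         : Fin (suc m) → ℕ
    parentEdge   : Fin (suc m) → Maybe (Fin m)
    parentEdge-child : ∀ i → parentEdge (child i) ≡ just i
    parentEdge-root  : parentEdge root ≡ nothing
    cover        : ∀ x → x ≡ root ⊎ ∃[ i ] x ≡ child i
    descends     : ∀ i → rank (parent i) < rank (child i)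
    joins        : ∀ i → Joins (pathEnds m) i (child i) (parent i)
    sum-split    : ∀ (g : Fin (suc m) → ℤ) →
      ℤ-Sum.sum g ≡ g root ℤ.+ ℤ-Sum.sum (g ∘ child)

rootedAtFirst : ∀ m → Rooting m
rootedAtFirst m = record
  { child = suc ; parent = inject₁ ; root = zero ; rank = toℕ
  ; parentEdge = λ { zero → nothing ; (suc i) → just i }
  ; parentEdge-child = λ _ → refl
  ; parentEdge-root = refl
  ; cover = λ { zero → inj₁ refl ; (suc i) → inj₂ (i , refl) }
  ; descends = λ i → s≤s (ℕₚ.≤-reflexive (toℕ-inject₁ i))
  ; joins = λ i → inj₂ refl
  ; sum-split = λ g → refl
  }

rootedAtLast : ∀ m → Rooting m
rootedAtLast m = record
  { child = inject₁ ; parent = suc ; root = fromℕ m ; rank = λ x → m ∸ toℕ x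
  ; parentEdge = lower ∘ Top.view
  ; parentEdge-child = λ i → cong lower (Top.view-inject₁ i)
  ; parentEdge-root = cong lower (Top.view-fromℕ m)
  ; cover = λ x → split (Top.view x)
  ; descends = λ i → ℕₚ.∸-monoʳ-< (s≤s (ℕₚ.≤-reflexive (toℕ-inject₁ i))) (toℕ<n i)
  ; joins = λ i → inj₁ refl
  ; sum-split = λ g → trans (ℤ-Sum.sum-init-last g) (ℤₚ.+-comm (ℤ-Sum.sum (g ∘ inject₁)) (g (fromℕ m)))
  }
  where
  lower : ∀ {n} {x : Fin (suc n)} → Top.View x → Maybe (Fin n)
  lower Top.‵fromℕ = nothing
  lower (Top.‵inject₁ i) = just i
  split : ∀ {n} {x : Fin (suc n)} → Top.View x → x ≡ fromℕ n ⊎ ∃[ i ] x ≡ inject₁ i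
  split Top.‵fromℕ = inj₁ refl
  split (Top.‵inject₁ i) = inj₂ (i , refl)

-- Corner trees of the grid

Grid : ℕ → Graph
Grid m = P (suc m) □ P (suc m)

module CornerTree {m} (R C : Rooting m) (χ : Fin m → Fin m → Bool) where
  private
    module R = Rooting R
    module C = Rooting C
    open Graph (Grid m) using (V; E)

  -- The vertex `(R.child i , C.child j)` keeps its vertical parent edge if `χ i j` is `true` and
  -- its horizontal one otherwise. The default `true` puts the vertical edges of the root column and
  -- the horizontal edges of the root row into every tree.
  inTree : E → Bool
  inTree (inj₁ (i , y)) = maybe (λ j → χ i j) true (C.parentEdge y)
  inTree (inj₂ (x , j)) = maybe (λ i → not (χ i j)) true (R.parentEdge x)

  tree : Subgraph (Grid m)
  tree = record { hasV = λ _ → true ; hasE = inTree ; closed = λ _ _ → tt , tt }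

  open Subgraph tree using (Adj)

  private
    parentOf : V → V
    parentOf (x , y) with R.parentEdge x | C.parentEdge y
    ... | nothing | nothing = x , y
    ... | just i  | nothing = R.parent i , y
    ... | nothing | just j  = x , C.parent j
    ... | just i  | just j  = if χ i j then (R.parent i , y) else (x , C.parent j)

    rank : V → ℕ
    rank (x , y) = R.rank x + C.rank y

    Step : V → V → Set
    Step v u = u ≡ parentOf v × rank u < rank v

    ends = Graph.ends (Grid m)

    rowJoins : ∀ i {y} → Joins ends (inj₁ (i , y)) (R.child i , y) (R.parent i , y)
    rowJoins i {y} with R.joins i
    ... | inj₁ eq = inj₁ (cong (λ p → (proj₁ p , y) , (proj₂ p , y)) eq)
    ... | inj₂ eq = inj₂ (cong (λ p → (proj₁ p , y) , (proj₂ p , y)) eq)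

    colJoins : ∀ {x} j → Joins ends (inj₂ (x , j)) (x , C.child j) (x , C.parent j)
    colJoins {x} j with C.joins j
    ... | inj₁ eq = inj₁ (cong (λ p → (x , proj₁ p) , (x , proj₂ p)) eq)
    ... | inj₂ eq = inj₂ (cong (λ p → (x , proj₁ p) , (x , proj₂ p)) eq)

    rowStep : ∀ i y → T (inTree (inj₁ (i , y))) → Step (R.child i , y) (R.parent i , y)
    rowStep i y e∈T = par , ℕₚ.+-monoˡ-< (C.rank y) (R.descends i)
      where
      par : (R.parent i , y) ≡ parentOf (R.child i , y)
      par rewrite R.parentEdge-child i with C.parentEdge y
      ... | nothing = refl
      ... | just j with χ i j
      -- The value `false` would leave the edge outside the tree, against `e∈T`.
      ... | true = refl

    colStep : ∀ x j → T (inTree (inj₂ (x , j))) → Step (x , C.child j) (x , C.parent j)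
    colStep x j e∈T = par , ℕₚ.+-monoʳ-< (R.rank x) (C.descends j)
      where
      par : (x , C.parent j) ≡ parentOf (x , C.child j)
      par rewrite C.parentEdge-child j with R.parentEdge x
      ... | nothing = refl
      ... | just i with χ i j
      ... | false = refl

    joins-cases : ∀ {e v u v′ u′} → Joins ends e v u → Joins ends e v′ u′ →
      (v ≡ v′ × u ≡ u′) ⊎ (v ≡ u′ × u ≡ v′)
    joins-cases (inj₁ p) (inj₁ q) with refl ← trans (sym p) q = inj₁ (refl , refl)
    joins-cases (inj₁ p) (inj₂ q) with refl ← trans (sym p) q = inj₂ (refl , refl)
    joins-cases (inj₂ p) (inj₁ q) with refl ← trans (sym p) q = inj₂ (refl , refl)
    joins-cases (inj₂ p) (inj₂ q) with refl ← trans (sym p) q = inj₁ (refl , refl)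

    -- An edge has only one unordered pair of ends, so a step from child to parent found for one
    -- listing of them orients every other listing.
    orient : ∀ {e v u v′ u′} → Joins ends e v u → Step v u → Joins ends e v′ u′ →
      Step v′ u′ ⊎ Step u′ v′
    orient {e} j s j′ with joins-cases {e} j j′
    ... | inj₁ (refl , refl) = inj₁ s
    ... | inj₂ (refl , refl) = inj₂ s

    oriented : ∀ {v u} → Adj v u → Step v u ⊎ Step u v
    oriented (inj₁ (i , y) , e∈T , j) = orient {inj₁ (i , y)} (rowJoins i) (rowStep i y e∈T) j
    oriented (inj₂ (x , i) , e∈T , j) = orient {inj₂ (x , i)} (colJoins i) (colStep x i e∈T) j

    Descends : V → Set
    Descends v = Adj v (parentOf v) × rank (parentOf v) < rank v

    step : ∀ e {v u} → T (inTree e) → Joins ends e v u → Step v u → Descends v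
    step e e∈T j (refl , lt) = (e , e∈T , j) , lt

    up : ∀ i y → T (inTree (inj₁ (i , y))) → Descends (R.child i , y)
    up i y e∈T = step (inj₁ (i , y)) e∈T (rowJoins i) (rowStep i y e∈T)

    left : ∀ x j → T (inTree (inj₂ (x , j))) → Descends (x , C.child j)
    left x j e∈T = step (inj₂ (x , j)) e∈T (colJoins j) (colStep x j e∈T)

    descend : ∀ v → v ≡ (R.root , C.root) ⊎ Descends v
    descend (x , y) with R.cover x | C.cover y
    ... | inj₁ refl       | inj₁ refl       = inj₁ refl
    ... | inj₂ (i , refl) | inj₁ refl       = inj₂ (up i C.root
      (subst (T ∘ maybe (λ j → χ i j) true) (sym C.parentEdge-root) tt))
    ... | inj₁ refl       | inj₂ (j , refl) = inj₂ (left R.root j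
      (subst (T ∘ maybe (λ i → not (χ i j)) true) (sym R.parentEdge-root) tt))
    ... | inj₂ (i , refl) | inj₂ (j , refl) with χ i j in eq
    ... | true  = inj₂ (up i (C.child j)
      (subst (T ∘ maybe (λ j → χ i j) true) (sym (C.parentEdge-child j)) (subst T (sym eq) tt)))
    ... | false = inj₂ (left (R.child i) j
      (subst (T ∘ maybe (λ i → not (χ i j)) true) (sym (R.parentEdge-child i)) (subst (T ∘ not) (sym eq) tt)))

  tree-spanning : SpanningTree (Grid m) tree
  tree-spanning = rooted⇒spanningTree tree rank parentOf (R.root , C.root) (λ _ → tt) descend oriented

-- Weight of a corner tree

sum-↑ : ∀ a {b} (g : Fin (a + b) → ℤ) →
  ℤ∑.sum g ≡ ℤ∑.sum (λ i → g (i ↑ˡ b)) ℤ.+ ℤ∑.sum (λ j → g (a ↑ʳ j))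
sum-↑ zero    g = sym (ℤₚ.+-identityˡ _)
sum-↑ (suc a) g = trans (cong (λ s → g zero ℤ.+ s) (sum-↑ a (g ∘ suc))) (sym (ℤₚ.+-assoc (g zero) _ _))

sum-combine : ∀ a {b} (g : Fin (a * b) → ℤ) →
  ℤ∑.sum g ≡ ℤ∑.sum (λ i → ℤ∑.sum (λ j → g (combine {a} i j)))
sum-combine zero        g = refl
sum-combine (suc a) {b} g = trans (sum-↑ b g)
  (cong (λ s → ℤ∑.sum (λ j → g (j ↑ˡ (a * b))) ℤ.+ s) (sum-combine a (λ k → g (b ↑ʳ k))))

-- The enumeration of a product graph lists all vertical edges first and then all horizontal ones,
-- each block lexicographically.
sum-edges : ∀ m (g : Graph.E (Grid m) → ℤ) →
  ℤ∑.sum (λ k → g (Inverse.from (Graph.E-finite (Grid m)) k)) ≡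
  ℤ∑.sum (λ i → ℤ∑.sum (λ y → g (inj₁ (i , y)))) ℤ.+ ℤ∑.sum (λ x → ℤ∑.sum (λ j → g (inj₂ (x , j))))
sum-edges m g = trans (sum-↑ a {b} (g ∘ edge)) (cong₂ ℤ._+_
  (trans (sum-combine m {suc m} (λ k → g (edge (k ↑ˡ b))))
    (ℤ∑.sum-cong-≗ λ i → ℤ∑.sum-cong-≗ λ y → cong g (vertical i y)))
  (trans (sum-combine (suc m) (λ k → g (edge (a ↑ʳ k))))
    (ℤ∑.sum-cong-≗ λ x → ℤ∑.sum-cong-≗ λ j → cong g (horizontal x j))))
  where
  a = m * suc m
  b = suc m * m
  edge = Inverse.from (Graph.E-finite (Grid m))
  vertical : ∀ i y → edge (combine i y ↑ˡ b) ≡ inj₁ (i , y)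
  vertical i y rewrite splitAt-↑ˡ a (combine i y) b = cong inj₁ (remQuot-combine i y)
  horizontal : ∀ x j → edge (a ↑ʳ combine x j) ≡ inj₂ (x , j)
  horizontal x j rewrite splitAt-↑ʳ a b (combine x j) = cong inj₂ (remQuot-combine x j)

value : Sign → ℤ
value s = s ◃ 1

module _ {m} (R C : Rooting m) (χ : Fin m → Fin m → Bool) (f : Labeling (Grid m)) where
  private
    module R = Rooting R
    module C = Rooting C
    open CornerTree R C χ

    term : Graph.E (Grid m) → ℤ
    term e = if inTree e then value (f e) else 0ℤ

    pick : ∀ b {p q : ℤ} → (if b then p else 0ℤ) ℤ.+ (if not b then q else 0ℤ) ≡ (if b then p else q)
    pick true  = ℤₚ.+-identityʳ _
    pick false = ℤₚ.+-identityˡ _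

    verticalSum : ∀ i → ℤ∑.sum (λ y → term (inj₁ (i , y))) ≡
      value (f (inj₁ (i , C.root))) ℤ.+ ℤ∑.sum (λ j → if χ i j then value (f (inj₁ (i , C.child j))) else 0ℤ)
    verticalSum i = trans (C.sum-split (λ y → term (inj₁ (i , y)))) (cong₂ ℤ._+_
      (cong (λ b → if maybe (λ j → χ i j) true b then value (f (inj₁ (i , C.root))) else 0ℤ) C.parentEdge-root)
      (ℤ∑.sum-cong-≗ λ j →
        cong (λ b → if maybe (λ j → χ i j) true b then value (f (inj₁ (i , C.child j))) else 0ℤ)
          (C.parentEdge-child j)))

    horizontalSum : ℤ∑.sum (λ x → ℤ∑.sum (λ j → term (inj₂ (x , j)))) ≡
      ℤ∑.sum (λ j → value (f (inj₂ (R.root , j)))) ℤ.+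
      ℤ∑.sum (λ i → ℤ∑.sum (λ j → if not (χ i j) then value (f (inj₂ (R.child i , j))) else 0ℤ))
    horizontalSum = trans (R.sum-split (λ x → ℤ∑.sum (λ j → term (inj₂ (x , j))))) (cong₂ ℤ._+_
      (ℤ∑.sum-cong-≗ λ j →
        cong (λ b → if maybe (λ i → not (χ i j)) true b then value (f (inj₂ (R.root , j))) else 0ℤ)
          R.parentEdge-root)
      (ℤ∑.sum-cong-≗ λ i → ℤ∑.sum-cong-≗ λ j →
        cong (λ b → if maybe (λ i → not (χ i j)) true b then value (f (inj₂ (R.child i , j))) else 0ℤ)
          (R.parentEdge-child i)))

    regroup : ∀ a b c d → (a ℤ.+ b) ℤ.+ (c ℤ.+ d) ≡ (a ℤ.+ c) ℤ.+ (b ℤ.+ d)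
    regroup = ℤ-Ring.solve-∀

  forcedWeight : ℤ
  forcedWeight = ℤ∑.sum (λ i → value (f (inj₁ (i , C.root)))) ℤ.+ ℤ∑.sum (λ j → value (f (inj₂ (R.root , j))))

  -- The root column and the root row lie in the tree whatever the choices; every other vertex
  -- contributes the label of its chosen parent edge.
  weight-cornerTree : weight (Grid m) f tree ≡ forcedWeight ℤ.+
    ℤ∑.sum (λ i → ℤ∑.sum (λ j → if χ i j then value (f (inj₁ (i , C.child j))) else value (f (inj₂ (R.child i , j)))))
  weight-cornerTree = begin
    weight (Grid m) f tree
      ≡⟨ sum-edges m term ⟩
    ℤ∑.sum (λ i → ℤ∑.sum (λ y → term (inj₁ (i , y)))) ℤ.+ ℤ∑.sum (λ x → ℤ∑.sum (λ j → term (inj₂ (x , j))))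
      ≡⟨ cong₂ ℤ._+_ (trans (ℤ∑.sum-cong-≗ verticalSum)
           (ℤ∑.∑-distrib-+ (λ i → value (f (inj₁ (i , C.root)))) (λ i → ℤ∑.sum (v i))))
           horizontalSum ⟩
    (ℤ∑.sum (λ i → value (f (inj₁ (i , C.root)))) ℤ.+ ℤ∑.sum (λ i → ℤ∑.sum (λ j → v i j))) ℤ.+
    (ℤ∑.sum (λ j → value (f (inj₂ (R.root , j)))) ℤ.+ ℤ∑.sum (λ i → ℤ∑.sum (λ j → h i j)))
      ≡⟨ regroup (ℤ∑.sum (λ i → value (f (inj₁ (i , C.root))))) (ℤ∑.sum (λ i → ℤ∑.sum (λ j → v i j))) _ _ ⟩
    forcedWeight ℤ.+ (ℤ∑.sum (λ i → ℤ∑.sum (λ j → v i j)) ℤ.+ ℤ∑.sum (λ i → ℤ∑.sum (λ j → h i j)))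
      ≡⟨ cong (λ s → forcedWeight ℤ.+ s) (sym (ℤ∑.∑-distrib-+ (λ i → ℤ∑.sum (v i)) (λ i → ℤ∑.sum (h i)))) ⟩
    forcedWeight ℤ.+ ℤ∑.sum (λ i → ℤ∑.sum (v i) ℤ.+ ℤ∑.sum (h i))
      -- The two candidate parent edges of one vertex are now paired, and exactly one of them is in
      -- the tree.
      ≡⟨ cong (λ s → forcedWeight ℤ.+ s) (ℤ∑.sum-cong-≗ λ i →
           trans (sym (ℤ∑.∑-distrib-+ (v i) (h i))) (ℤ∑.sum-cong-≗ λ j → pick (χ i j))) ⟩
    forcedWeight ℤ.+ ℤ∑.sum (λ i → ℤ∑.sum (λ j → if χ i j then value (f (inj₁ (i , C.child j))) else value (f (inj₂ (R.child i , j)))))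
      ∎
    where
    open ≡-Reasoning
    v h : Fin m → Fin m → ℤ
    v i j = if χ i j then value (f (inj₁ (i , C.child j))) else 0ℤ
    h i j = if not (χ i j) then value (f (inj₂ (R.child i , j))) else 0ℤ

-- Finite sums of naturals and constancy along a path

sum-mono-≤ : ∀ {n} {f g : Fin n → ℕ} → (∀ i → f i ≤ g i) → ℕ∑.sum f ≤ ℕ∑.sum g
sum-mono-≤ {zero}  le = z≤n
sum-mono-≤ {suc n} le = ℕₚ.+-mono-≤ (le zero) (sum-mono-≤ (le ∘ suc))

sum-≤ : ∀ {n} {f : Fin n → ℕ} {c} → (∀ i → f i ≤ c) → ℕ∑.sum f ≤ n * c
sum-≤ {zero}  le = z≤n
sum-≤ {suc n} le = ℕₚ.+-mono-≤ (le zero) (sum-≤ (le ∘ suc))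

term≤sum : ∀ {n} (f : Fin n → ℕ) i → f i ≤ ℕ∑.sum f
term≤sum f zero    = ℕₚ.m≤m+n (f zero) _
term≤sum f (suc i) = ℕₚ.≤-trans (term≤sum (f ∘ suc) i) (ℕₚ.m≤n+m _ (f zero))

sum≡0⇒≡0 : ∀ {n} {f : Fin n → ℕ} → ℕ∑.sum f ≡ 0 → ∀ i → f i ≡ 0
sum≡0⇒≡0 {f = f} eq i = ℕₚ.n≤0⇒n≡0 (subst (f i ≤_) eq (term≤sum f i))

-- Pigeonhole: `n` positive terms would sum to at least `n`.
sum<n⇒zero : ∀ {n} (f : Fin n → ℕ) → ℕ∑.sum f < n → ∃[ i ] f i ≡ 0
sum<n⇒zero {suc n} f lt with f zero in eq
... | zero  = zero , eq
... | suc k with sum<n⇒zero (f ∘ suc) (ℕₚ.≤-trans (s≤s (ℕₚ.m≤n+m _ k)) (ℕₚ.≤-pred lt))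
... | i , eq′ = suc i , eq′

path-constant : ∀ {A : Set} {n} (g : Fin (suc n) → A) →
  (∀ i → g (inject₁ i) ≡ g (suc i)) → ∀ i → g i ≡ g zero
path-constant         g eq zero    = refl
path-constant {n = suc _} g eq (suc i) = trans (path-constant (g ∘ suc) (eq ∘ suc) i) (sym (eq zero))

-- Mismatches at face corners and minority vertical edges

mismatch : Sign → Sign → ℕ
mismatch Sign.+ Sign.+ = 0
mismatch Sign.- Sign.- = 0
mismatch Sign.+ Sign.- = 1
mismatch Sign.- Sign.+ = 1

mismatch≡0⇒≡ : ∀ {s t} → mismatch s t ≡ 0 → s ≡ t
mismatch≡0⇒≡ {Sign.+} {Sign.+} _ = refl
mismatch≡0⇒≡ {Sign.-} {Sign.-} _ = refl

mismatch-refl : ∀ s → mismatch s s ≡ 0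
mismatch-refl Sign.+ = refl
mismatch-refl Sign.- = refl

mismatch≤1 : ∀ s t → mismatch s t ≤ 1
mismatch≤1 Sign.+ Sign.+ = z≤n
mismatch≤1 Sign.- Sign.- = z≤n
mismatch≤1 Sign.+ Sign.- = s≤s z≤n
mismatch≤1 Sign.- Sign.+ = s≤s z≤n

-- v i y is the label of the edge (i , y)–(i + 1 , y), and h x j that of (x , j)–(x , j + 1).
module _ {m} (v : Fin m → Fin (suc m) → Sign) (h : Fin (suc m) → Fin m → Sign) where

  cornerMismatch : (r c : Fin m → Fin (suc m)) → Fin m → Fin m → ℕ
  cornerMismatch r c i j = mismatch (v i (c j)) (h (r i) j)

  mismatches : (r c : Fin m → Fin (suc m)) → ℕ
  mismatches r c = ℕ∑.sum (λ i → ℕ∑.sum (cornerMismatch r c i))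

  -- The corners are top left, top right and bottom left. Agreement at these three already makes all
  -- four labels of a face equal.
  threeCornerMismatches : ℕ
  threeCornerMismatches =
    mismatches inject₁ inject₁ + (mismatches inject₁ suc + mismatches suc inject₁)

module _ {n} (v : Fin (suc n) → Fin (suc (suc n)) → Sign)
  (h : Fin (suc (suc n)) → Fin (suc n) → Sign) where

  private
    tl tr bl faceMismatch : Fin (suc n) → Fin (suc n) → ℕ
    tl = cornerMismatch v h inject₁ inject₁
    tr = cornerMismatch v h inject₁ suc
    bl = cornerMismatch v h suc inject₁
    faceMismatch i j = tl i j + (tr i j + bl i j)

    columnMismatch : Fin (suc n) → ℕ
    columnMismatch j = ℕ∑.sum (λ i → faceMismatch i j)

    ∑∑-distrib-+ : (f g : Fin (suc n) → Fin (suc n) → ℕ) →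
      ℕ∑.sum (λ i → ℕ∑.sum (λ j → f i j + g i j)) ≡ ℕ∑.sum (λ i → ℕ∑.sum (f i)) + ℕ∑.sum (λ i → ℕ∑.sum (g i))
    ∑∑-distrib-+ f g = trans (ℕ∑.sum-cong-≗ λ i → ℕ∑.∑-distrib-+ (f i) (g i))
      (ℕ∑.∑-distrib-+ (λ i → ℕ∑.sum (f i)) (λ i → ℕ∑.sum (g i)))

    total-rows : ℕ∑.sum (λ i → ℕ∑.sum (faceMismatch i)) ≡ threeCornerMismatches v h
    total-rows = trans (∑∑-distrib-+ tl (λ i j → tr i j + bl i j))
      (cong (λ s → mismatches v h inject₁ inject₁ + s) (∑∑-distrib-+ tr bl))

    total-columns : ℕ∑.sum columnMismatch ≡ threeCornerMismatches v h
    total-columns = trans (sym (ℕ∑.∑-comm faceMismatch)) total-rows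

    module _ {i j} (clean : faceMismatch i j ≡ 0) where
      private
        rest = ℕₚ.m+n≡0⇒n≡0 (tl i j) clean

      top≡left : v i (inject₁ j) ≡ h (inject₁ i) j
      top≡left = mismatch≡0⇒≡ (ℕₚ.m+n≡0⇒m≡0 (tl i j) clean)

      left≡right : v i (inject₁ j) ≡ v i (suc j)
      left≡right = trans top≡left (sym (mismatch≡0⇒≡ (ℕₚ.m+n≡0⇒m≡0 (tr i j) rest)))

      bottom≡left : v i (inject₁ j) ≡ h (suc i) j
      bottom≡left = mismatch≡0⇒≡ (ℕₚ.m+n≡0⇒n≡0 (tr i j) rest)

    -- Consecutive faces of a column share a horizontal edge, whose label equals the left label of
    -- both faces.
    column-constant : ∀ {j} → columnMismatch j ≡ 0 → ∀ i i′ → v i (inject₁ j) ≡ v i′ (inject₁ j)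
    column-constant {j} clean i i′ = trans (toTop i) (sym (toTop i′))
      where
      face = sum≡0⇒≡0 {f = λ i → faceMismatch i j} clean
      toTop : ∀ i → v i (inject₁ j) ≡ v zero (inject₁ j)
      toTop = path-constant (λ i → v i (inject₁ j))
        λ i → trans (bottom≡left (face (inject₁ i))) (sym (top≡left (face (suc i))))

  -- Fewer mismatches than rows leave a clean row of faces, all of whose vertical labels are one
  -- sign `t`. Each clean column meets that row and so carries `t` throughout; a column that is not
  -- clean pays for its own possible minority label in every row.
  few-minority-verticals⁺ : threeCornerMismatches v h < suc n →
    ∃[ t ] (ℕ∑.sum (λ i → mismatch t (v i zero)) ≤ suc n * threeCornerMismatches v h ×
            ℕ∑.sum (λ i → ℕ∑.sum (λ j → mismatch t (v i (suc j)))) ≤ suc n * threeCornerMismatches v h)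
  few-minority-verticals⁺ few
    with sum<n⇒zero (λ i → ℕ∑.sum (faceMismatch i)) (subst (_< suc n) (sym total-rows) few)
  ... | i₀ , clean = t ,
    -- Vertical edges at `zero` are left sides of the first column of faces; all others are right
    -- sides. The comb weight is split in the same way.
    sum-≤ (λ i → ℕₚ.≤-trans (left-≤ i zero)
      (subst (columnMismatch zero ≤_) total-columns (term≤sum columnMismatch zero))) ,
    sum-≤ (λ i → ℕₚ.≤-trans (sum-mono-≤ (right-≤ i)) (ℕₚ.≤-reflexive total-columns))
    where
    t = v i₀ zero
    row-constant : ∀ y → v i₀ y ≡ t
    row-constant = path-constant (v i₀) λ j → left≡right (sum≡0⇒≡0 {f = faceMismatch i₀} clean j)

    left-≡ : ∀ i j → columnMismatch j ≡ 0 → v i (inject₁ j) ≡ t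
    left-≡ i j eq = trans (column-constant eq i i₀) (row-constant (inject₁ j))

    matches : ∀ {s} → s ≡ t → mismatch t s ≡ 0
    matches refl = mismatch-refl t

    -- In a column with a mismatch the right side is at least 1, which bounds any single mismatch;
    -- in a clean column the label is `t`.
    left-≤ : ∀ i j → mismatch t (v i (inject₁ j)) ≤ columnMismatch j
    left-≤ i j with columnMismatch j in eq
    ... | zero  = ℕₚ.≤-reflexive (matches (left-≡ i j eq))
    ... | suc k = ℕₚ.≤-trans (mismatch≤1 t _) (s≤s z≤n)

    right-≤ : ∀ i j → mismatch t (v i (suc j)) ≤ columnMismatch j
    right-≤ i j with columnMismatch j in eq
    ... | zero  = ℕₚ.≤-reflexive (matches
      (trans (sym (left≡right (sum≡0⇒≡0 {f = λ i → faceMismatch i j} eq i))) (left-≡ i j eq)))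
    ... | suc k = ℕₚ.≤-trans (mismatch≤1 t _) (s≤s z≤n)

few-minority-verticals : ∀ {m} (v : Fin m → Fin (suc m) → Sign) (h : Fin (suc m) → Fin m → Sign) →
  threeCornerMismatches v h < m →
  ∃[ t ] (ℕ∑.sum (λ i → mismatch t (v i zero)) ≤ m * threeCornerMismatches v h ×
          ℕ∑.sum (λ i → ℕ∑.sum (λ j → mismatch t (v i (suc j)))) ≤ m * threeCornerMismatches v h)
-- For `m` equal to 0 the hypothesis is impossible.
few-minority-verticals {suc _} = few-minority-verticals⁺

-- Signed sums against counts of minority signs

+-sum : ∀ {n} (f : Fin n → ℕ) → ℤ∑.sum (λ i → + f i) ≡ + ℕ∑.sum f
+-sum {zero}  f = refl
+-sum {suc n} f = cong (λ s → + f zero ℤ.+ s) (+-sum (f ∘ suc))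

value-mismatch : ∀ t s → value t ℤ.* value s ℤ.+ + (2 * mismatch t s) ≡ + 1
value-mismatch Sign.+ Sign.+ = refl
value-mismatch Sign.+ Sign.- = refl
value-mismatch Sign.- Sign.+ = refl
value-mismatch Sign.- Sign.- = refl

-- Integer terms and an arbitrary total `c` per term let the identity be iterated: first over the
-- labels of a row with `c` equal to 1, then over the row sums.
tally : ∀ t {n} (g : Fin n → ℤ) (μ : Fin n → ℕ) {c} →
  (∀ i → t ℤ.* g i ℤ.+ + (2 * μ i) ≡ + c) →
  t ℤ.* ℤ∑.sum g ℤ.+ + (2 * ℕ∑.sum μ) ≡ + (n * c)
tally t {zero}  g μ eq = cong (ℤ._+ + 0) (ℤₚ.*-zeroʳ t)
tally t {suc n} g μ {c} eq = begin
  t ℤ.* (g zero ℤ.+ G) ℤ.+ + (2 * (μ zero + M))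
    ≡⟨ cong (λ k → t ℤ.* (g zero ℤ.+ G) ℤ.+ + k) (ℕₚ.*-distribˡ-+ 2 (μ zero) M) ⟩
  t ℤ.* (g zero ℤ.+ G) ℤ.+ (+ (2 * μ zero) ℤ.+ + (2 * M))
    ≡⟨ regroup t (g zero) G (+ (2 * μ zero)) (+ (2 * M)) ⟩
  (t ℤ.* g zero ℤ.+ + (2 * μ zero)) ℤ.+ (t ℤ.* G ℤ.+ + (2 * M))
    ≡⟨ cong₂ ℤ._+_ (eq zero) (tally t (g ∘ suc) (μ ∘ suc) (eq ∘ suc)) ⟩
  + (c + n * c) ∎
  where
  open ≡-Reasoning
  G = ℤ∑.sum (g ∘ suc)
  M = ℕ∑.sum (μ ∘ suc)
  regroup : ∀ t a b p q → t ℤ.* (a ℤ.+ b) ℤ.+ (p ℤ.+ q) ≡ (t ℤ.* a ℤ.+ p) ℤ.+ (t ℤ.* b ℤ.+ q)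
  regroup = ℤ-Ring.solve-∀

tally-values : ∀ t {n} (g : Fin n → Sign) →
  value t ℤ.* ℤ∑.sum (λ i → value (g i)) ℤ.+ + (2 * ℕ∑.sum (λ i → mismatch t (g i))) ≡ + (n * 1)
tally-values t g = tally (value t) (value ∘ g) (mismatch t ∘ g) (λ i → value-mismatch t (g i))

-- Extremal corner trees and the comb

positive negative : Sign → Bool
positive Sign.+ = true
positive Sign.- = false
negative Sign.+ = false
negative Sign.- = true

module _ {m} (f : Labeling (Grid m)) where
  vertical : Fin m → Fin (suc m) → Sign
  vertical i y = f (inj₁ (i , y))

  horizontal : Fin (suc m) → Fin m → Sign
  horizontal x j = f (inj₂ (x , j))

  module _ (R C : Rooting m) where
    private
      module R = Rooting R
      module C = Rooting C

    -- The vertical label alone decides: keeping it exactly when it is + attains the larger of the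
    -- two candidate labels, and keeping it exactly when it is - attains the smaller.
    maxChoice minChoice : Fin m → Fin m → Bool
    maxChoice i j = positive (vertical i (C.child j))
    minChoice i j = negative (vertical i (C.child j))

    maxTree minTree : Subgraph (Grid m)
    maxTree = CornerTree.tree R C maxChoice
    minTree = CornerTree.tree R C minChoice

    private
      chosen : (Fin m → Fin m → Bool) → Fin m → Fin m → ℤ
      chosen χ i j = if χ i j then value (vertical i (C.child j)) else value (horizontal (R.child i) j)

      gap : Fin m → Fin m → ℕ
      gap = cornerMismatch vertical horizontal R.child C.child

      choice-gap : ∀ s t → (if positive s then value s else value t) ≡
        (if negative s then value s else value t) ℤ.+ + (mismatch s t + mismatch s t)
      choice-gap Sign.+ Sign.+ = refl
      choice-gap Sign.+ Sign.- = refl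
      choice-gap Sign.- Sign.+ = refl
      choice-gap Sign.- Sign.- = refl

    -- Each mismatch separates the two weights by 2, while two weights of absolute value at most `M`
    -- differ by at most `2 * M`.
    mismatches-≤ : ∀ {M} → ∣ weight (Grid m) f maxTree ∣ ≤ M → ∣ weight (Grid m) f minTree ∣ ≤ M →
      mismatches vertical horizontal R.child C.child ≤ M
    mismatches-≤ {M} max≤ min≤ = ℕₚ.*-cancelˡ-≤ 2 (begin
      2 * D                      ≡⟨ cong (λ s → D + s) (ℕₚ.+-identityʳ D) ⟩
      D + D                      ≡⟨ cong ∣_∣ difference ⟨
      ∣ w₊ ℤ.- w₋ ∣                ≤⟨ ℤₚ.∣i-j∣≤∣i∣+∣j∣ w₊ w₋ ⟩
      ∣ w₊ ∣ + ∣ w₋ ∣            ≤⟨ ℕₚ.+-mono-≤ max≤ min≤ ⟩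
      M + M                      ≡⟨ cong (λ s → M + s) (ℕₚ.+-identityʳ M) ⟨
      2 * M                      ∎)
      where
      open ℕₚ.≤-Reasoning
      w₊ = weight (Grid m) f maxTree
      w₋ = weight (Grid m) f minTree
      -- The forced edges are common to both trees, so `F` is the forced part of `maxTree` as well.
      F = forcedWeight R C minChoice f
      D = mismatches vertical horizontal R.child C.child
      Σ₋ = ℤ∑.sum (λ i → ℤ∑.sum (chosen minChoice i))

      sums : ℤ∑.sum (λ i → ℤ∑.sum (chosen maxChoice i)) ≡ Σ₋ ℤ.+ + (D + D)
      sums = trans
        (ℤ∑.sum-cong-≗ λ i → trans
          (ℤ∑.sum-cong-≗ λ j → choice-gap (vertical i (C.child j)) (horizontal (R.child i) j))
          (trans (ℤ∑.∑-distrib-+ (chosen minChoice i) (λ j → + (gap i j + gap i j)))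
            (cong (λ s → ℤ∑.sum (chosen minChoice i) ℤ.+ s)
              (trans (+-sum (λ j → gap i j + gap i j)) (cong +_ (ℕ∑.∑-distrib-+ (gap i) (gap i)))))))
        (trans (ℤ∑.∑-distrib-+ (λ i → ℤ∑.sum (chosen minChoice i)) (λ i → + (ℕ∑.sum (gap i) + ℕ∑.sum (gap i))))
          (cong (λ s → Σ₋ ℤ.+ s)
            (trans (+-sum (λ i → ℕ∑.sum (gap i) + ℕ∑.sum (gap i)))
              (cong +_ (ℕ∑.∑-distrib-+ (λ i → ℕ∑.sum (gap i)) (λ i → ℕ∑.sum (gap i)))))))

      cancel : ∀ a b c → (a ℤ.+ (b ℤ.+ c)) ℤ.- (a ℤ.+ b) ≡ c
      cancel = ℤ-Ring.solve-∀

      difference : w₊ ℤ.- w₋ ≡ + (D + D)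
      difference = trans
        (cong₂ ℤ._-_
          (trans (weight-cornerTree R C maxChoice f) (cong (λ s → F ℤ.+ s) sums))
          (weight-cornerTree R C minChoice f))
        (cancel F Σ₋ (+ (D + D)))

  comb : Subgraph (Grid m)
  comb = CornerTree.tree (rootedAtFirst m) (rootedAtFirst m) (λ _ _ → true)

  -- The comb has `m + m + m * m` edges. If all were labelled `t`, this would be the absolute
  -- weight; each edge with the other label costs at most 2.
  comb-weight-≥ : ∀ t →
    m + m + m * m ≤ ∣ weight (Grid m) f comb ∣ +
      2 * (ℕ∑.sum (λ i → mismatch t (vertical i zero)) + m +
             ℕ∑.sum (λ i → ℕ∑.sum (λ j → mismatch t (vertical i (suc j)))))
  comb-weight-≥ t = begin
    m + m + m * m
      ≡⟨ cong₂ (λ p q → p + p + m * q) (ℕₚ.*-identityʳ m) (ℕₚ.*-identityʳ m) ⟨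
    n₁ + n₁ + m * n₁
      ≡⟨ cong ∣_∣ total ⟨
    ∣ value t ℤ.* w ℤ.+ + (2 * (A + B + D)) ∣
      ≤⟨ ℤₚ.∣i+j∣≤∣i∣+∣j∣ (value t ℤ.* w) _ ⟩
    ∣ value t ℤ.* w ∣ + 2 * (A + B + D)
      ≡⟨ cong (_+ 2 * (A + B + D)) (trans (ℤₚ.∣i*j∣≡∣i∣*∣j∣ (value t) w)
           (trans (cong (_* ∣ w ∣) (ℤₚ.abs-◃ t 1)) (ℕₚ.*-identityˡ ∣ w ∣))) ⟩
    ∣ w ∣ + 2 * (A + B + D)
      ≤⟨ ℕₚ.+-monoʳ-≤ ∣ w ∣ (ℕₚ.*-monoʳ-≤ 2 (ℕₚ.+-monoˡ-≤ D (ℕₚ.+-monoʳ-≤ A B≤m))) ⟩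
    ∣ w ∣ + 2 * (A + m + D) ∎
    where
    open ℕₚ.≤-Reasoning
    w = weight (Grid m) f comb
    n₁ = m * 1
    A = ℕ∑.sum (λ i → mismatch t (vertical i zero))
    B = ℕ∑.sum (λ j → mismatch t (horizontal zero j))
    D = ℕ∑.sum (λ i → ℕ∑.sum (λ j → mismatch t (vertical i (suc j))))
    a = ℤ∑.sum (λ i → value (vertical i zero))
    b = ℤ∑.sum (λ j → value (horizontal zero j))
    d = ℤ∑.sum (λ i → ℤ∑.sum (λ j → value (vertical i (suc j))))

    -- The horizontal labels on the side are not controlled, but there are only `m` of them.
    B≤m : B ≤ m
    B≤m = subst (B ≤_) (ℕₚ.*-identityʳ m) (sum-≤ (λ j → mismatch≤1 t (horizontal zero j)))

    regroup : ∀ t a b d A B D → t ℤ.* (a ℤ.+ b ℤ.+ d) ℤ.+ (A ℤ.+ B ℤ.+ D) ≡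
      (t ℤ.* a ℤ.+ A) ℤ.+ (t ℤ.* b ℤ.+ B) ℤ.+ (t ℤ.* d ℤ.+ D)
    regroup = ℤ-Ring.solve-∀

    double : ∀ A B D → 2 * (A + B + D) ≡ 2 * A + 2 * B + 2 * D
    double = ℕ-Ring.solve-∀

    total : value t ℤ.* w ℤ.+ + (2 * (A + B + D)) ≡ + (n₁ + n₁ + m * n₁)
    total = trans
      (cong₂ (λ p q → value t ℤ.* p ℤ.+ + q)
        (weight-cornerTree (rootedAtFirst m) (rootedAtFirst m) (λ _ _ → true) f) (double A B D))
      (trans (regroup (value t) a b d (+ (2 * A)) (+ (2 * B)) (+ (2 * D)))
        (cong₂ ℤ._+_
          (cong₂ ℤ._+_ (tally-values t (λ i → vertical i zero)) (tally-values t (horizontal zero)))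
          (tally (value t) (λ i → ℤ∑.sum (λ j → value (vertical i (suc j))))
            (λ i → ℕ∑.sum (λ j → mismatch t (vertical i (suc j))))
            (λ i → tally-values t (λ j → vertical i (suc j))))))

-- An unbalanced tree among seven candidates

largest : ∀ {A : Set} (size : A → ℕ) x xs →
  ∃[ y ] (size x ≤ size y × All (λ z → size z ≤ size y) xs)
largest size x xs = argmax size x xs , f[⊥]≤f[argmax] {f = size} x xs , f[xs]≤f[argmax] {f = size} x xs

module _ {m} (f : Labeling (Grid m)) where
  private
    first last : Rooting m
    first = rootedAtFirst m
    last  = rootedAtLast m

    Tree = ∃ (SpanningTree (Grid m))

    size : Tree → ℕ
    size (T , _) = ∣ weight (Grid m) f T ∣

    extremes : Rooting m → Rooting m → List Tree → List Tree
    extremes R C Ts =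
      (maxTree f R C , CornerTree.tree-spanning R C (maxChoice f R C)) ∷
      (minTree f R C , CornerTree.tree-spanning R C (minChoice f R C)) ∷ Ts

    trees : List Tree
    -- The child map is `inject₁` for `last` and `suc` for `first`, so the three roots match the
    -- summands of `threeCornerMismatches` in order.
    trees = extremes last last (extremes last first (extremes first last []))

    combTree : Tree
    combTree = comb f , CornerTree.tree-spanning first first (λ _ _ → true)

    -- The bounds give `m * m + 2 * m ≤ M + 2 * m + 12 * m * M`, where 12 is twice 3 + 3 from `A`
    -- and `D`. Since `m` is at least `12 * M + 1`, this forces `m ≤ M`, a contradiction.
    near-monochromatic-comb-absurd : ∀ {w M μ A D} → 12 * M < m → w ≤ M → μ ≤ M + (M + M) →
      A ≤ m * μ → D ≤ m * μ →
      ¬ (m + m + m * m ≤ w + 2 * (A + m + D))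
    near-monochromatic-comb-absurd {w} {M} {μ} {A} {D} 12M<m w≤M μ≤3M A≤ D≤ le = ℕₚ.<⇒≱ 12M<m
      (ℕₚ.≤-trans m≤M (ℕₚ.m≤m+n M (11 * M)))
      where
      open ℕₚ.≤-Reasoning
      bound : ∀ {X} → X ≤ m * μ → X ≤ m * (M + (M + M))
      bound X≤ = ℕₚ.≤-trans X≤ (ℕₚ.*-monoʳ-≤ m μ≤3M)
      split : ∀ m M → m + (m + m + m * (12 * M)) ≡ m + m + m * suc (12 * M)
      split = ℕ-Ring.solve-∀
      collect : ∀ m M → M + 2 * (m * (M + (M + M)) + m + m * (M + (M + M))) ≡
        M + (m + m + m * (12 * M))
      collect = ℕ-Ring.solve-∀
      m≤M : m ≤ M
      m≤M = ℕₚ.+-cancelʳ-≤ (m + m + m * (12 * M)) m M (begin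
        m + (m + m + m * (12 * M))    ≡⟨ split m M ⟩
        m + m + m * suc (12 * M)      ≤⟨ ℕₚ.+-monoʳ-≤ (m + m) (ℕₚ.*-monoʳ-≤ m 12M<m) ⟩
        m + m + m * m                 ≤⟨ le ⟩
        w + 2 * (A + m + D)
          ≤⟨ ℕₚ.+-mono-≤ w≤M (ℕₚ.*-monoʳ-≤ 2 (ℕₚ.+-mono-≤ (ℕₚ.+-monoˡ-≤ m (bound A≤)) (bound D≤))) ⟩
        M + 2 * (m * (M + (M + M)) + m + m * (M + (M + M)))
          ≡⟨ collect m M ⟩
        M + (m + m + m * (12 * M))    ∎)

    balanced⇒small : ∀ {M} → size combTree ≤ M → All (λ T → size T ≤ M) trees → ¬ (12 * M < m)
    balanced⇒small {M} comb≤ (b₁ ∷ b₂ ∷ b₃ ∷ b₄ ∷ b₅ ∷ b₆ ∷ []) 12M<m =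
      let t , A≤ , D≤ = few-minority-verticals (vertical f) (horizontal f) few in
      near-monochromatic-comb-absurd 12M<m comb≤ μ≤3M A≤ D≤ (comb-weight-≥ f t)
      where
      μ≤3M : threeCornerMismatches (vertical f) (horizontal f) ≤ M + (M + M)
      μ≤3M = ℕₚ.+-mono-≤ (mismatches-≤ f last last b₁ b₂)
        (ℕₚ.+-mono-≤ (mismatches-≤ f last first b₃ b₄) (mismatches-≤ f first last b₅ b₆))
      few : threeCornerMismatches (vertical f) (horizontal f) < m
      few = ℕₚ.≤-<-trans μ≤3M
        (ℕₚ.≤-<-trans (ℕₚ.+-monoʳ-≤ M (ℕₚ.+-monoʳ-≤ M (ℕₚ.m≤m+n M (9 * M)))) 12M<m)

  -- The witness is the heaviest of the comb and the six extremal trees, so it remains only to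
  -- refute `12 * M < m` for its size `M`; decidability of the order then yields the bound.
  unbalanced-tree : ∃[ T ] (SpanningTree (Grid m) T × m ≤ 12 * ∣ weight (Grid m) f T ∣)
  unbalanced-tree =
    let (T , spanning) , comb≤ , trees≤ = largest size combTree trees in
    T , spanning , ℕₚ.≮⇒≥ (balanced⇒small comb≤ trees≤)

-- From grid side `m` to `k` vertices per side, and to rationals

-- The constant doubles because `suc m ≤ m + m` once `m` is positive.
1+m≤24w : ∀ {m} w → 1 ≤ m → m ≤ 12 * w → suc m ≤ 24 * w
1+m≤24w {m} w 1≤m m≤12w = begin
  suc m            ≤⟨ ℕₚ.+-monoˡ-≤ m 1≤m ⟩
  m + m            ≤⟨ ℕₚ.+-mono-≤ m≤12w m≤12w ⟩
  12 * w + 12 * w  ≡⟨ ℕₚ.*-distribʳ-+ w 12 12 ⟨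
  24 * w           ∎
  where open ℕₚ.≤-Reasoning

unbalanced-spanningTree : ∀ k → 2 ≤ k → (f : Labeling (P k □ P k)) →
  ∃[ T ] (SpanningTree (P k □ P k) T × k ≤ 24 * ∣ weight (P k □ P k) f T ∣)
unbalanced-spanningTree (suc m) (s≤s 1≤m) f =
  let T , spanning , m≤12w = unbalanced-tree f in
  T , spanning , 1+m≤24w ∣ weight (Grid m) f T ∣ 1≤m m≤12w

-- In unnormalised rationals the inequality is a cross-multiplication of integers, free of the
-- reduction to lowest terms.
k/24≤w : ∀ k w → k ≤ 24 * w → (+ 1 ℚ./ 24) ℚ.* fromℕℚ k ℚ.≤ fromℕℚ w
k/24≤w k w le = ℚₚ.toℚᵘ-cancel-≤ (begin
  ℚ.toℚᵘ ((+ 1 ℚ./ 24) ℚ.* fromℕℚ k)   ≃⟨ ℚₚ.toℚᵘ-homo-* (+ 1 ℚ./ 24) (fromℕℚ k) ⟩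
  mkℚᵘ (+ 1) 23 ℚᵘ.* ℚ.toℚᵘ (fromℕℚ k) ≃⟨ ℚᵘₚ.*-congˡ {mkℚᵘ (+ 1) 23} (ℚₚ.toℚᵘ-fromℚᵘ (mkℚᵘ (+ k) 0)) ⟩
  mkℚᵘ (+ 1) 23 ℚᵘ.* mkℚᵘ (+ k) 0      ≤⟨ *≤* numerators ⟩
  mkℚᵘ (+ w) 0                         ≃⟨ ℚₚ.toℚᵘ-fromℚᵘ (mkℚᵘ (+ w) 0) ⟨
  ℚ.toℚᵘ (fromℕℚ w)                    ∎)
  where
  open ℚᵘₚ.≤-Reasoning
  numerators : (+ 1 ℤ.* + k) ℤ.* + 1 ℤ.≤ + w ℤ.* + 24
  numerators = subst₂ ℤ._≤_
    (sym (trans (ℤₚ.*-identityʳ (+ 1 ℤ.* + k)) (ℤₚ.*-identityˡ (+ k))))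
    (trans (ℤₚ.pos-* 24 w) (ℤₚ.*-comm (+ 24) (+ w)))
    (ℤ.+≤+ le)

theorem1p5 : ∃[ c ] (ℚ.0ℚ ℚ.< c ×
    (∀ (k : ℕ) → 2 ≤ k →
    (∀ (d : ℕ) → IsDiscrepancy (P k □ P k) (SpanningTree (P k □ P k)) d →
    c ℚ.* fromℕℚ k ℚ.≤ fromℕℚ d)
    × (∀ (f : Labeling (P k □ P k)) →
    ∃[ T ] (SpanningTree (P k □ P k) T × c ℚ.* fromℕℚ k ℚ.≤ fromℕℚ ∣ weight (P k □ P k) f T ∣))))
theorem1p5 = (+ 1 ℚ./ 24) , ℚₚ.positive⁻¹ (+ 1 ℚ./ 24) , λ k 2≤k →
  -- The minimum `d` is attained at some `f` as the maximum over its trees, so the tree found for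
  -- this `f` has absolute weight at most `d`.
  (λ { d ((f , _ , maximal) , _) →
    let T , spanning , k≤24w = unbalanced-spanningTree k 2≤k f in
    k/24≤w k d (ℕₚ.≤-trans k≤24w
      (ℕₚ.*-monoʳ-≤ 24 (maximal ∣ weight (P k □ P k) f T ∣ (T , spanning , refl)))) }) ,
  λ f →
    let T , spanning , k≤24w = unbalanced-spanningTree k 2≤k f in
    T , spanning , k/24≤w k ∣ weight (P k □ P k) f T ∣ k≤24w
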